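{- For every integer $n\ge 4$, the star Cayley graph $Sym_n(st)$ satisfies $$N(Sym_n(st),1)=2\quad\text{and}\quad N(Sym_n(st),2)=2(n-1).$$
   Context: For an integer $n$, $Sym_n$ is the symmetric group on $\{1,\dots,n\}$. The star Cayley graph $Sym_n(st)$ is the Cayley graph with vertex set $Sym_n$ and edges $\{g,gs\}$ for $g\in Sym_n$, $s\in st$, where $st=\{(1,i): 1<i\le n\}$ is the set of prefix-transpositions ($(1,i)$ is the transposition interchanging $1$ and $i$). For a finite connected simple graph $\Gamma$ with vertex set $V(\Gamma)$ and path distance $d$, let $B_r(x)=\{y\in V(\Gamma): d(x,y)\le r\}$ and $$N(\Gamma,r)=\max_{x,y\in V(\Gamma),\ x\ne y}|B_r(x)\cap B_r(y)|.$$ -}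

module Defs where

open import Algebra.Bundles using (Group)
import Algebra.Properties.Group as GroupProperties
open import Data.Fin.Base using (Fin; toℕ)
open import Data.Fin.Permutation
  using (Permutation′; _⟨$⟩ˡ_; _⟨$⟩ʳ_; _∘ₚ_; flip; id; inverseˡ; inverseʳ; transpose)
  renaming (_≈_ to _≈ₚ_)
open import Data.Fin.Properties using (_≟_)
open import Data.Nat.Base using (ℕ; suc; _≤_; _<_)
open import Data.Nat.Properties using (<-irrefl)
open import Data.Product.Base using (Σ; ∃; ∃₂; _×_; _,_; proj₁)
open import Data.Sum.Base using (_⊎_; inj₁; inj₂; swap)
open import Function.Bundles using (Inverse)
open import Level using (Level; 0ℓ; _⊔_) renaming (suc to lsuc)
open import Relation.Binary.Bundles using (Setoid)
import Relation.Binary.Construct.On as On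
open import Relation.Binary.Core using (Rel)
open import Relation.Binary.Definitions using (Symmetric; _Respects₂_)
open import Relation.Binary.PropositionalEquality
  using (_≡_; refl; sym; trans; cong)
  renaming (setoid to ≡-setoid)
open import Relation.Nullary.Decidable using (dec-true)
open import Relation.Nullary.Negation using (¬_)
open import Relation.Unary using (Pred; _∈_; _∩_)

private
  variable
    a c ℓ p : Level

-- Elements of the subset are compared by their first component only, so that
-- neither membership proofs nor ≈-equal representatives are counted twice.

HasCardinality : (S : Setoid c ℓ) → Pred (Setoid.Carrier S) p → ℕ → Set (c ⊔ ℓ ⊔ p)
HasCardinality S P k =
  Inverse (≡-setoid (Fin k)) (On.setoid {B = Σ (Setoid.Carrier S) P} S proj₁)

record SimpleGraph c ℓ a : Set (lsuc (c ⊔ ℓ ⊔ a)) where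
  field
    vertices : Setoid c ℓ

  open Setoid vertices public
    using (_≈_; _≉_) renaming (Carrier to Vertex)

  field
    Adjacent    : Rel Vertex a
    respects    : Adjacent Respects₂ _≈_
    symmetric   : Symmetric Adjacent
    irreflexive : ∀ {x y} → x ≈ y → ¬ Adjacent x y

module _ (Γ : SimpleGraph c ℓ a) where
  open SimpleGraph Γ

  data Walk : Vertex → Vertex → ℕ → Set (c ⊔ ℓ ⊔ a) where
    stop : ∀ {x y} → x ≈ y → Walk x y 0
    step : ∀ {x y z k} → Adjacent x y → Walk y z k → Walk x z (suc k)

  -- Path distance as a relation: d(x, y) = k.
  Distance : Vertex → Vertex → ℕ → Set (c ⊔ ℓ ⊔ a)
  Distance x y k = Walk x y k × (∀ l → Walk x y l → k ≤ l)

  Ball : ℕ → Vertex → Pred Vertex (c ⊔ ℓ ⊔ a)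
  Ball r x y = ∃ λ k → Distance x y k × k ≤ r

  -- N(Γ, r) = m as a relation.  The second component asks that every
  -- intersection has a cardinality, so the bound cannot hold vacuously.
  MaxBallIntersection : ℕ → ℕ → Set (c ⊔ ℓ ⊔ a)
  MaxBallIntersection r m =
      (∃₂ λ x y → x ≉ y × HasCardinality vertices (Ball r x ∩ Ball r y) m)
    × (∀ x y → x ≉ y →
         ∃ λ k → HasCardinality vertices (Ball r x ∩ Ball r y) k × k ≤ m)

-- x and y are adjacent iff {x, y} = {g, g s} for some g and some s in S.

cayleyGraph : (G : Group c ℓ) (S : Pred (Group.Carrier G) p) →
              (∀ {s} → s ∈ S → ¬ (Group._≈_ G s (Group.ε G))) →
              SimpleGraph c ℓ (c ⊔ ℓ ⊔ p)
cayleyGraph G S ε∉S = record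
  { vertices    = G.setoid
  ; Adjacent    = Adj
  ; respects    = respʳ , respˡ
  ; symmetric   = symm
  ; irreflexive = irrefl
  }
  where
  module G = Group G
  open G using (_≈_; _∙_; ε)

  Adj : G.Carrier → G.Carrier → Set _
  Adj x y = ∃ λ s → s ∈ S × (y ≈ x ∙ s ⊎ x ≈ y ∙ s)

  symm : ∀ {x y} → Adj x y → Adj y x
  symm (s , s∈S , e) = s , s∈S , swap e

  respʳ : ∀ {x y z} → y ≈ z → Adj x y → Adj x z
  respʳ y≈z (s , s∈S , inj₁ e) = s , s∈S , inj₁ (G.trans (G.sym y≈z) e)
  respʳ y≈z (s , s∈S , inj₂ e) = s , s∈S , inj₂ (G.trans e (G.∙-congʳ y≈z))

  respˡ : ∀ {x y z} → y ≈ z → Adj y x → Adj z x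
  respˡ y≈z e = symm (respʳ y≈z (symm e))

  fixed : ∀ {x y s} → x ≈ y → y ≈ x ∙ s → s ≈ ε
  fixed {x} {y} {s} x≈y y≈xs =
    GroupProperties.identityʳ-unique G x s (G.sym (G.trans x≈y y≈xs))

  irrefl : ∀ {x y} → x ≈ y → ¬ Adj x y
  irrefl x≈y (s , s∈S , inj₁ e) = ε∉S s∈S (fixed x≈y e)
  irrefl x≈y (s , s∈S , inj₂ e) = ε∉S s∈S (fixed (G.sym x≈y) e)

-- Sym n acts on Fin n, i.e. the points 1,…,n are numbered 0,…,n-1.  Products
-- are composed as functions, (g h)(i) = g (h i), whereas _∘ₚ_ applies its left
-- argument first.

Sym : ℕ → Group 0ℓ 0ℓ
Sym n = record
  { Carrier = Permutation′ n
  ; _≈_     = _≈ₚ_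
  ; _∙_     = λ g h → h ∘ₚ g
  ; ε       = id
  ; _⁻¹     = flip
  ; isGroup = record
    { isMonoid = record
      { isSemigroup = record
        { isMagma = record
          { isEquivalence = record
            { refl  = λ _ → refl
            ; sym   = λ e i → sym (e i)
            ; trans = λ e f i → trans (e i) (f i)
            }
          ; ∙-cong = λ {_} {g′} {h} e f i →
              trans (e (h ⟨$⟩ʳ i)) (cong (g′ ⟨$⟩ʳ_) (f i))
          }
        ; assoc = λ _ _ _ _ → refl
        }
      ; identity = (λ _ _ → refl) , (λ _ _ → refl)
      }
    ; inverse = (λ g _ → inverseˡ g) , (λ g _ → inverseʳ g)
    ; ⁻¹-cong = λ {g} {h} e i →
        trans (sym (inverseˡ h))
          (cong (h ⟨$⟩ˡ_) (trans (sym (e (g ⟨$⟩ˡ i))) (inverseʳ g)))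
    }
  }

PrefixTransposition : ∀ n → Pred (Permutation′ n) 0ℓ
PrefixTransposition n π =
  ∃₂ λ (o i : Fin n) → toℕ o ≡ 0 × 0 < toℕ i × π ≈ₚ transpose o i

prefixTransposition≉id : ∀ n {π} → π ∈ PrefixTransposition n → ¬ (π ≈ₚ id)
prefixTransposition≉id n {π} (o , i , o≡0 , 0<i , e) π≈id =
  <-irrefl (trans (sym o≡0) (cong toℕ o≡i)) 0<i
  where
  transpose-o : transpose o i ⟨$⟩ʳ o ≡ i
  transpose-o rewrite dec-true (o ≟ o) refl = refl

  o≡i : o ≡ i
  o≡i = trans (sym (π≈id o)) (trans (e o) transpose-o)

starGraph : ℕ → SimpleGraph 0ℓ 0ℓ 0ℓ
starGraph n = cayleyGraph (Sym n) (PrefixTransposition n) (λ {π} → prefixTransposition≉id n {π})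

{-# OPTIONS --safe #-}

-- A permutation w within distance 2 of the identity is determined by
-- a = w 0 and b = w⁻¹ 0.  A point of B₂(x) ∩ B₂(y) is x w, where the quotient
-- g = x⁻¹ y ≠ e factors as w v with w and v within distance 2 of e.  Comparing
-- both sides at 0, a, g⁻¹ 0 and g⁻¹ a shows that a ≠ 0 leaves only two
-- candidates for b: a and g a if g fixes 0, and g⁻¹ 0 and g⁻¹ a otherwise.  If
-- g moves 0, then w = e (a = b = 0) is also possible, but it takes the place of
-- the pair a = g 0, b = g⁻¹ a = 0, which belongs to no w.  Hence there are at
-- most 2(n-1) points, and this is attained by x = e, y = (0 1).  For radius 1
-- the only candidates are w = e and w = (0 g⁻¹0).

module Submission where

open import Defs
open import Algebra.Bundles using (Group)
open import Data.Fin.Base using (Fin; zero; suc; remQuot; combine)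
open import Data.Fin.Patterns using (0F; 1F)
open import Data.Fin.Permutation
  using (Permutation′; _⟨$⟩ˡ_; _⟨$⟩ʳ_; inverseˡ; inverseʳ; transpose)
  renaming (_≈_ to _≈ₚ_)
open import Data.Fin.Permutation.Components using (transpose-inverse)
open import Data.Fin.Properties
  using (_≟_; all?; any?; injective⇒≤; suc-injective; combine-remQuot; remQuot-combine)
open import Data.List.Base using (List; _∷_; length; lookup; filter; deduplicate; tabulate)
import Data.List.Membership.Setoid as Membership
open import Data.List.Membership.Setoid.Properties
  using (All[≉]⇒∉; ∈-resp-≈; ∈-lookup; ∈-filter⁺; ∈-filter⁻; ∈-deduplicate⁺; ∈-deduplicate⁻; ∈-tabulate⁺)
open import Data.List.Properties using (length-filter; length-deduplicate; length-tabulate)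
open import Data.List.Relation.Unary.AllPairs using (_∷_)
import Data.List.Relation.Unary.Any as Any
open import Data.List.Relation.Unary.Any.Properties using (lookup-index)
import Data.List.Relation.Unary.Unique.DecSetoid.Properties as UniqueDec
open import Data.List.Relation.Unary.Unique.Setoid using (Unique)
open import Data.Nat.Base using (ℕ; zero; suc; _≤_; _<_; _*_; _∸_; z≤n; s≤s; z<s)
open import Data.Nat.Induction using (<-wellFounded)
open import Data.Nat.Properties
  using (≤-refl; ≤-reflexive; ≤-trans; ≤-antisym; <⇒≤; ≮⇒≥; anyUpTo?)
open import Data.Product.Base using (∃; ∃₂; Σ; _×_; _,_; proj₁; proj₂; uncurry)
open import Data.Sum.Base using (_⊎_; inj₁; inj₂)
open import Function.Base using (_∘_)
open import Function.Bundles using (Inverse)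
open import Induction.WellFounded using (Acc; acc)
open import Level using (Level; 0ℓ)
open import Relation.Binary.Bundles using (Setoid; DecSetoid)
open import Relation.Binary.PropositionalEquality
  using (_≡_; _≢_; refl; sym; trans; cong; subst; module ≡-Reasoning)
open import Relation.Nullary.Decidable using (Dec; yes; no; map′; _×-dec_; dec-true; dec-false)
open import Relation.Nullary.Negation using (¬_; contradiction)
open import Relation.Unary using (Pred; Decidable; _∈_; _∩_)

private
  variable
    a c ℓ p : Level

-- Cardinalities of subsets of a setoid, bounded by injections and by covers.

module _ (S : Setoid c ℓ) where
  open Setoid S using (Carrier; _≈_) renaming (sym to ≈-sym; trans to ≈-trans)

  lookup-injective : ∀ {xs} → Unique S xs → ∀ i j → lookup xs i ≈ lookup xs j → i ≡ j
  lookup-injective (_ ∷ _)   zero    zero    _ = refl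
  lookup-injective {_ ∷ xs} (x∉xs ∷ _) zero (suc j) e =
    contradiction (∈-resp-≈ S (≈-sym e) (∈-lookup S xs j)) (All[≉]⇒∉ S x∉xs)
  lookup-injective {_ ∷ xs} (x∉xs ∷ _) (suc i) zero e =
    contradiction (∈-resp-≈ S e (∈-lookup S xs i)) (All[≉]⇒∉ S x∉xs)
  lookup-injective (_ ∷ u) (suc i) (suc j) e = cong suc (lookup-injective u i j e)

  injection⇒≤cardinality : ∀ {P : Pred Carrier p} {m k} → HasCardinality S P k →
    (f : Fin m → Carrier) → (∀ i → P (f i)) → (∀ i j → f i ≈ f j → i ≡ j) → m ≤ k
  injection⇒≤cardinality card f f∈P f-inj = injective⇒≤ {f = λ i → from (f i , f∈P i)}
    λ {i} {j} e → f-inj i j (≈-trans (≈-sym (strictlyInverseˡ (f i , f∈P i)))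
                   (≈-trans (to-cong e) (strictlyInverseˡ (f j , f∈P j))))
    where open Inverse card

module _ (D : DecSetoid c ℓ) where
  open DecSetoid D using (Carrier; _≈_)
    renaming (setoid to S; _≟_ to _≈?_; refl to ≈-refl; sym to ≈-sym; trans to ≈-trans)

  -- Filtering the `m` values of `f` by `P` and removing repetitions leaves a list that enumerates
  -- `P` exactly once up to `≈`. So `f` may repeat values or leave `P`.
  cover⇒cardinality : ∀ {P : Pred Carrier p} {m} → Decidable P →
    (∀ {x y} → x ≈ y → P x → P y) →
    (f : Fin m → Carrier) → (∀ {x} → P x → ∃ λ i → x ≈ f i) →
    ∃ λ k → HasCardinality S P k × k ≤ m
  cover⇒cardinality {P = P} {m} P? resp f covers = length xs , card , bound
    where
    ys xs : List Carrier
    ys = filter P? (tabulate f)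
    xs = deduplicate _≈?_ ys

    bound : length xs ≤ m
    bound = ≤-trans (length-deduplicate _≈?_ ys)
      (≤-trans (length-filter P? (tabulate f)) (≤-reflexive (length-tabulate f)))

    open Membership S using () renaming (_∈_ to _∈ₗ_)

    P⇒∈ : ∀ {x} → P x → x ∈ₗ xs
    P⇒∈ Px = let i , x≈fi = covers Px in
      ∈-deduplicate⁺ S _≈?_ (λ y≈x z≈x → ≈-trans z≈x (≈-sym y≈x))
        (∈-filter⁺ S P? resp (∈-resp-≈ S (≈-sym x≈fi) (∈-tabulate⁺ S i)) Px)

    lookup∈P : ∀ i → P (lookup xs i)
    lookup∈P i = proj₂ (∈-filter⁻ S P? resp {xs = tabulate f} (∈-deduplicate⁻ S _≈?_ ys (∈-lookup S xs i)))

    position : Σ Carrier P → Fin (length xs)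
    position (_ , Px) = Any.index (P⇒∈ Px)

    lookup-position : ∀ z → proj₁ z ≈ lookup xs (position z)
    lookup-position (_ , Px) = lookup-index (P⇒∈ Px)

    lookup-inj : ∀ i j → lookup xs i ≈ lookup xs j → i ≡ j
    lookup-inj = lookup-injective S (UniqueDec.deduplicate-! D ys)

    card : HasCardinality S P (length xs)
    card = record
      { to        = λ i → lookup xs i , lookup∈P i
      ; from      = position
      ; to-cong   = λ { refl → ≈-refl }
      ; from-cong = λ {z} {z′} z≈z′ → lookup-inj (position z) (position z′)
          (≈-trans (≈-sym (lookup-position z)) (≈-trans z≈z′ (lookup-position z′)))
      ; inverse   = (λ { {z} refl → ≈-sym (lookup-position z) })
                  , λ {i} {z} z≈ → lookup-inj (position z) i (≈-trans (≈-sym (lookup-position z)) z≈)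
      }

-- Balls in a graph whose walks are decidable.

module _ (Γ : SimpleGraph c ℓ a)
         (walk? : ∀ k x y → Dec (Walk Γ x y k)) where
  open SimpleGraph Γ

  -- `Ball` demands the exact distance. Since walks of each length are decidable, the given walk is
  -- replaced by a shorter one, by well-founded recursion, until none exists.
  walk⇒ball : ∀ {r k x y} → Walk Γ x y k → k ≤ r → Ball Γ r x y
  walk⇒ball {k = k} = go k (<-wellFounded k)
    where
    go : ∀ {r} k → Acc _<_ k → ∀ {x y} → Walk Γ x y k → k ≤ r → Ball Γ r x y
    go k (acc rec) {x} {y} w k≤r with anyUpTo? (λ l → walk? l x y) k
    ... | yes (l , l<k , w′) = go l (rec l<k) w′ (≤-trans (<⇒≤ l<k) k≤r)
    ... | no ¬shorter = k , (w , λ l w′ → ≮⇒≥ (λ l<k → ¬shorter (l , l<k , w′))) , k≤r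

  ball? : ∀ r x → Decidable (Ball Γ r x)
  ball? r x y = map′
    (λ { (k , s≤s k≤r , w) → walk⇒ball w k≤r })
    (λ { (k , (w , _) , k≤r) → k , s≤s k≤r , w })
    -- The search bound is strict, so `suc r` stands for lengths up to `r`.
    (anyUpTo? (λ k → walk? k x y) (suc r))

walk-respʳ : ∀ {Γ : SimpleGraph c ℓ a} {x y z k} →
  SimpleGraph._≈_ Γ y z → Walk Γ x y k → Walk Γ x z k
walk-respʳ {Γ = Γ} y≈z (stop x≈y) = stop (Setoid.trans (SimpleGraph.vertices Γ) x≈y y≈z)
walk-respʳ         y≈z (step e w) = step e (walk-respʳ y≈z w)

walk-respˡ : ∀ {Γ : SimpleGraph c ℓ a} {x y z k} →
  SimpleGraph._≈_ Γ x y → Walk Γ x z k → Walk Γ y z k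
walk-respˡ {Γ = Γ} x≈y (stop x≈z) = stop (trans′ (sym′ x≈y) x≈z)
  where open Setoid (SimpleGraph.vertices Γ) renaming (sym to sym′; trans to trans′)
walk-respˡ {Γ = Γ} x≈y (step e w) = step (proj₂ (SimpleGraph.respects Γ) x≈y e) w

ball-resp : ∀ {Γ : SimpleGraph c ℓ a} {r x y z} →
  SimpleGraph._≈_ Γ y z → Ball Γ r x y → Ball Γ r x z
ball-resp {Γ = Γ} y≈z (k , (w , least) , k≤r) =
  k , (walk-respʳ {Γ = Γ} y≈z w , λ l w′ → least l (walk-respʳ {Γ = Γ} (sym′ y≈z) w′)) , k≤r
  where open Setoid (SimpleGraph.vertices Γ) renaming (sym to sym′)

-- Values of transpositions.

transpose-ˡ : ∀ {n} (i j : Fin n) → transpose i j ⟨$⟩ʳ i ≡ j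
transpose-ˡ i j rewrite dec-true (i ≟ i) refl = refl

transpose-ʳ : ∀ {n} (i j : Fin n) → transpose i j ⟨$⟩ʳ j ≡ i
transpose-ʳ i j with j ≟ i
... | yes j≡i = j≡i
... | no _ rewrite dec-true (j ≟ j) refl = refl

transpose-≢ : ∀ {n} {i j k : Fin n} → k ≢ i → k ≢ j → transpose i j ⟨$⟩ʳ k ≡ k
transpose-≢ {i = i} {j} {k} k≢i k≢j
  rewrite dec-false (k ≟ i) k≢i | dec-false (k ≟ j) k≢j = refl

transpose-involutive : ∀ {n} (i j k : Fin n) →
  transpose i j ⟨$⟩ʳ (transpose i j ⟨$⟩ʳ k) ≡ k
transpose-involutive {n} i j k = by-cases (k ≟ i) (k ≟ j)
  where
  t : Fin n → Fin n
  t = transpose i j ⟨$⟩ʳ_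

  by-cases : Dec (k ≡ i) → Dec (k ≡ j) → t (t k) ≡ k
  by-cases (yes refl) _ = trans (cong t (transpose-ˡ k j)) (transpose-ʳ k j)
  by-cases (no _) (yes refl) = trans (cong t (transpose-ʳ i k)) (transpose-ˡ i k)
  by-cases (no k≢i) (no k≢j) = trans (cong t (transpose-≢ k≢i k≢j)) (transpose-≢ k≢i k≢j)

⟨$⟩ʳ-injective : ∀ {n} (π : Permutation′ n) {i j} → π ⟨$⟩ʳ i ≡ π ⟨$⟩ʳ j → i ≡ j
⟨$⟩ʳ-injective π e = trans (sym (inverseˡ π)) (trans (cong (π ⟨$⟩ˡ_) e) (inverseˡ π))

⟨$⟩ʳ⇒⟨$⟩ˡ : ∀ {n} (π : Permutation′ n) {i j} → π ⟨$⟩ʳ i ≡ j → π ⟨$⟩ˡ j ≡ i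
⟨$⟩ʳ⇒⟨$⟩ˡ π refl = inverseˡ π

-- Permutations within distance 2 of the identity.

module _ {m : ℕ} where

  private
    V : Set
    V = Permutation′ (suc m)

    open Group (Sym (suc m)) using (_∙_; _⁻¹; ε)

  star : Fin (suc m) → V
  star = transpose zero

  -- The permutations within distance 2 of the identity are the w which form
  -- the cycle b → 0 → a → b, where a and b may coincide or both vanish.
  record Cyclic (w : V) (a b : Fin (suc m)) : Set where
    field
      at-0  : w ⟨$⟩ʳ zero ≡ a
      at-b  : w ⟨$⟩ʳ b ≡ zero
      at-a  : a ≢ b → w ⟨$⟩ʳ a ≡ b
      fixed : ∀ {i} → i ≢ zero → i ≢ a → i ≢ b → w ⟨$⟩ʳ i ≡ i

  open Cyclic

  cyclic-id : Cyclic ε zero zero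
  cyclic-id = record { at-0 = refl ; at-b = refl ; at-a = λ _ → refl ; fixed = λ _ _ _ → refl }

  cyclic-star : ∀ i → Cyclic (star i) i i
  cyclic-star i = record
    { at-0 = transpose-ˡ zero i
    ; at-b = transpose-ʳ zero i
    ; at-a = λ i≢i → contradiction refl i≢i
    ; fixed = λ j≢0 j≢i _ → transpose-≢ j≢0 j≢i
    }

  -- The right factor acts first: 0 goes to `j`, which `star i` fixes. Hence the parameters appear
  -- in the order `j i`.
  cyclic-star-star : ∀ {i j} → i ≢ zero → j ≢ zero → i ≢ j → Cyclic (star i ∙ star j) j i
  cyclic-star-star {i} {j} i≢0 j≢0 i≢j = record
    { at-0 = trans (cong (star i ⟨$⟩ʳ_) (transpose-ˡ zero j)) (transpose-≢ j≢0 (i≢j ∘ sym))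
    ; at-b = trans (cong (star i ⟨$⟩ʳ_) (transpose-≢ i≢0 i≢j)) (transpose-ʳ zero i)
    ; at-a = λ _ → trans (cong (star i ⟨$⟩ʳ_) (transpose-ʳ zero j)) (transpose-ˡ zero i)
    ; fixed = λ k≢0 k≢j k≢i →
        trans (cong (star i ⟨$⟩ʳ_) (transpose-≢ k≢0 k≢j)) (transpose-≢ k≢0 k≢i)
    }

  cyclic-⁻¹ : ∀ {w a b} → Cyclic w a b → Cyclic (w ⁻¹) b a
  cyclic-⁻¹ {w} cw = record
    { at-0 = ⟨$⟩ʳ⇒⟨$⟩ˡ w (at-b cw)
    ; at-b = ⟨$⟩ʳ⇒⟨$⟩ˡ w (at-0 cw)
    ; at-a = λ b≢a → ⟨$⟩ʳ⇒⟨$⟩ˡ w (at-a cw (b≢a ∘ sym))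
    ; fixed = λ i≢0 i≢b i≢a → ⟨$⟩ʳ⇒⟨$⟩ˡ w (fixed cw i≢0 i≢a i≢b)
    }

  -- The cycle b → 0 → a → b when a and b are both zero or both nonzero, and the
  -- identity when only b is zero.
  cycle : Fin (suc m) → Fin (suc m) → V
  cycle a b = star a ∙ transpose a b

  cyclic-unique : ∀ {w a b} → Cyclic w a b → w ≈ₚ cycle a b
  cyclic-unique {w} {a} {b} cw i = by-cases (i ≟ b) (i ≟ a) (i ≟ zero)
    where
    s : Fin (suc m) → Fin (suc m)
    s = star a ⟨$⟩ʳ_

    b≢0 : a ≢ b → b ≢ zero
    b≢0 a≢b refl = a≢b (trans (sym (at-0 cw)) (at-b cw))

    -- Testing `i ≡ b` first settles the point `a` when `a` and `b` coincide, so that `at-a` is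
    -- called only with `a ≢ b`.
    by-cases : Dec (i ≡ b) → Dec (i ≡ a) → Dec (i ≡ zero) → w ⟨$⟩ʳ i ≡ cycle a b ⟨$⟩ʳ i
    by-cases (yes refl) _ _ = trans (at-b cw)
      (sym (trans (cong s (transpose-ʳ a i)) (transpose-ʳ zero a)))
    by-cases (no i≢b) (yes refl) _ = trans (at-a cw i≢b)
      (sym (trans (cong s (transpose-ˡ a b)) (transpose-≢ (b≢0 i≢b) (i≢b ∘ sym))))
    by-cases (no i≢b) (no i≢a) (yes refl) = trans (at-0 cw)
      (sym (trans (cong s (transpose-≢ i≢a i≢b)) (transpose-ˡ zero a)))
    by-cases (no i≢b) (no i≢a) (no i≢0) = trans (fixed cw i≢0 i≢a i≢b)
      (sym (trans (cong s (transpose-≢ i≢a i≢b)) (transpose-≢ i≢0 i≢a)))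

  cycle-diagonal : ∀ a → cycle a a ≈ₚ star a
  cycle-diagonal a i = sym (cyclic-unique (cyclic-star a) i)

  -- Both 0 and `b` are sent to 0, so `b` is 0 by injectivity, and `cycle zero zero` is a trivial
  -- product.
  cyclic-0⇒id : ∀ {w b} → Cyclic w zero b → w ≈ₚ ε
  cyclic-0⇒id {w} {b} cw i with ⟨$⟩ʳ-injective w {zero} {b} (trans (at-0 cw) (sym (at-b cw)))
  ... | refl = trans (cyclic-unique cw i) (transpose-inverse zero zero)

  -- The inverse of `v` has the same parameters as `w`, so the two agree by `cyclic-unique`.
  cyclic-∙-inverse : ∀ {w v a b} → Cyclic w a b → Cyclic v b a → w ∙ v ≈ₚ ε
  cyclic-∙-inverse {w} {v} cw cv i = begin
    w ⟨$⟩ʳ (v ⟨$⟩ʳ i)  ≡⟨ cyclic-unique cw _ ⟩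
    _                  ≡⟨ cyclic-unique (cyclic-⁻¹ cv) _ ⟨
    v ⟨$⟩ˡ (v ⟨$⟩ʳ i)  ≡⟨ inverseˡ v ⟩
    i                  ∎
    where open ≡-Reasoning

  -- Factorisations of a nontrivial permutation into two cyclic ones.

  module Factorisation {g w v : V} {a b c d : Fin (suc m)}
    (g≉ε : ¬ g ≈ₚ ε) (g≈wv : g ≈ₚ w ∙ v) (cw : Cyclic w a b) (cv : Cyclic v c d) where

    g-d : g ⟨$⟩ʳ d ≡ a
    g-d = trans (g≈wv d) (trans (cong (w ⟨$⟩ʳ_) (at-b cv)) (at-0 cw))

    v⟨g⁻¹0⟩ : v ⟨$⟩ʳ (g ⟨$⟩ˡ zero) ≡ b
    v⟨g⁻¹0⟩ = ⟨$⟩ʳ-injective w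
      (trans (sym (g≈wv (g ⟨$⟩ˡ zero))) (trans (inverseʳ g) (sym (at-b cw))))

    not-inverse : ¬ (c ≡ b × d ≡ a)
    not-inverse (refl , refl) =
      g≉ε (λ i → trans (g≈wv i) (cyclic-∙-inverse cw cv i))

    -- Since `w` sends both `c` and `b` to 0, they coincide. If `a` were 0, then `d` would be 0 too,
    -- and `w` and `v` would be inverse to each other. If `a ≢ b`, then `a` avoids 0, `c` and `d`,
    -- so `v` fixes it and `g` sends it to `w a = b`.
    fixing : g ⟨$⟩ʳ zero ≡ zero → a ≢ zero × (b ≡ a ⊎ b ≡ g ⟨$⟩ʳ a)
    fixing g0 = a≢0 , b-cases
      where
      c≡b : c ≡ b
      c≡b = ⟨$⟩ʳ-injective w (trans (cong (w ⟨$⟩ʳ_) (sym (at-0 cv)))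
        (trans (sym (g≈wv zero)) (trans g0 (sym (at-b cw)))))

      a≢0 : a ≢ zero
      a≢0 refl = not-inverse (c≡b , ⟨$⟩ʳ-injective g (trans g-d (sym g0)))

      b-cases : b ≡ a ⊎ b ≡ g ⟨$⟩ʳ a
      b-cases with a ≟ b
      ... | yes a≡b = inj₁ (sym a≡b)
      ... | no a≢b = inj₂ (sym (trans (g≈wv a)
              (trans (cong (w ⟨$⟩ʳ_) (fixed cv a≢0 (λ a≡c → a≢b (trans a≡c c≡b)) a≢d)) (at-a cw a≢b))))
        where
        a≢d : a ≢ d
        a≢d a≡d = not-inverse (c≡b , sym a≡d)

    -- Put `k = g⁻¹ 0`, so that `v k = b` and `k ≢ 0`. Now `k = d` would give `a = g d = 0`. If
    -- `k = c`, then `v` sends it to `d = g⁻¹ a`. Otherwise `v` fixes `k`.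
    moving : g ⟨$⟩ʳ zero ≢ zero → a ≢ zero → b ≡ g ⟨$⟩ˡ zero ⊎ b ≡ g ⟨$⟩ˡ a
    moving g0≢0 a≢0 with g ⟨$⟩ˡ zero ≟ d
    ... | yes k≡d = contradiction (trans (sym g-d) (trans (cong (g ⟨$⟩ʳ_) (sym k≡d)) (inverseʳ g))) a≢0
    ... | no k≢d with g ⟨$⟩ˡ zero ≟ c
    ...   | yes k≡c = inj₂ (trans (sym v⟨g⁻¹0⟩) (trans (cong (v ⟨$⟩ʳ_) k≡c)
              (trans (at-a cv (λ c≡d → k≢d (trans k≡c c≡d))) (sym (⟨$⟩ʳ⇒⟨$⟩ˡ g g-d)))))
    ...   | no k≢c = inj₁ (trans (sym v⟨g⁻¹0⟩) (fixed cv k≢0 k≢c k≢d))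
      where
      k≢0 : g ⟨$⟩ˡ zero ≢ zero
      k≢0 k≡0 = g0≢0 (trans (cong (g ⟨$⟩ʳ_) (sym k≡0)) (inverseʳ g))

  -- The family `u` is chosen from `g` before any factorisation is given, so one family serves the
  -- whole intersection. The `Fin 2` index selects the alternative for `b`; the `Fin m` index is the
  -- predecessor of a nonzero `a`.
  cover₂ : ∀ (g : V) → ¬ g ≈ₚ ε → ∃ λ (u : Fin 2 × Fin m → V) →
    ∀ {w v a b c d} → g ≈ₚ w ∙ v → Cyclic w a b → Cyclic v c d → ∃ λ i → w ≈ₚ u i
  cover₂ g g≉ε with g ⟨$⟩ʳ zero in g0
  ... | zero = u , covered
    where
    u : Fin 2 × Fin m → V
    u (0F , i) = cycle (suc i) (suc i)
    u (1F , i) = cycle (suc i) (g ⟨$⟩ʳ suc i)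

    covered : ∀ {w v a b c d} → g ≈ₚ w ∙ v → Cyclic w a b → Cyclic v c d → ∃ λ i → w ≈ₚ u i
    covered {w} {v} {a} g≈wv cw cv with Factorisation.fixing {g} {w} {v} g≉ε g≈wv cw cv g0
    covered {a = zero}  g≈wv cw cv | a≢0 , _ = contradiction refl a≢0
    covered {a = suc i} g≈wv cw cv | _ , inj₁ refl = (0F , i) , cyclic-unique cw
    covered {a = suc i} g≈wv cw cv | _ , inj₂ refl = (1F , i) , cyclic-unique cw
  ... | suc h = u , covered
    where
    u : Fin 2 × Fin m → V
    u (0F , i) = cycle (suc i) (g ⟨$⟩ˡ zero)
    u (1F , i) = cycle (suc i) (g ⟨$⟩ˡ suc i)

    covered : ∀ {w v a b c d} → g ≈ₚ w ∙ v → Cyclic w a b → Cyclic v c d → ∃ λ i → w ≈ₚ u i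
    -- As `g 0 = suc h`, the entry at `(1F , h)` is `cycle (suc h) zero`, where two equal
    -- transpositions cancel to the identity.
    covered {w} {a = zero} g≈wv cw cv = (1F , h) , λ i → trans (cyclic-0⇒id cw i)
      (sym (trans (cong (λ j → cycle (suc h) j ⟨$⟩ʳ i) (⟨$⟩ʳ⇒⟨$⟩ˡ g g0))
                  (transpose-inverse zero (suc h))))
    covered {w} {v} {suc i} g≈wv cw cv
      with Factorisation.moving {g} {w} {v} g≉ε g≈wv cw cv (λ e → contradiction (trans (sym g0) e) λ ()) (λ ())
    ... | inj₁ refl = (0F , i) , cyclic-unique cw
    ... | inj₂ refl = (1F , i) , cyclic-unique cw

  -- Let `a = b` be nonzero and `k = g⁻¹ 0`, so `v k = a`. If `k` were 0, then `c = a` and the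
  -- factors would be inverse; if `k` were `c`, then `a` would be 0. So `v` fixes `k`, and `a = k`.
  cover₁ : ∀ (g : V) → ¬ g ≈ₚ ε → ∃ λ (u : Fin 2 → V) →
    ∀ {w v a c} → g ≈ₚ w ∙ v → Cyclic w a a → Cyclic v c c → ∃ λ i → w ≈ₚ u i
  cover₁ g g≉ε = u , covered
    where
    k : Fin (suc m)
    k = g ⟨$⟩ˡ zero

    u : Fin 2 → V
    u 0F = ε
    u 1F = star k

    covered : ∀ {w v a c} → g ≈ₚ w ∙ v → Cyclic w a a → Cyclic v c c → ∃ λ i → w ≈ₚ u i
    covered {a = zero} g≈wv cw cv = 0F , cyclic-0⇒id cw
    covered {w} {v} {suc i} {c} g≈wv cw cv = 1F ,
      λ j → trans (cyclic-unique cw j) (trans (cycle-diagonal (suc i) j) (cong (λ l → star l ⟨$⟩ʳ j) i≡k))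
      where
      open Factorisation {g} {w} {v} g≉ε g≈wv cw cv

      k≢0 : k ≢ zero
      k≢0 k≡0 = not-inverse (c≡i , c≡i)
        where
        c≡i : c ≡ suc i
        c≡i = trans (sym (at-0 cv)) (trans (cong (v ⟨$⟩ʳ_) (sym k≡0)) v⟨g⁻¹0⟩)

      k≢c : k ≢ c
      k≢c k≡c with trans (sym v⟨g⁻¹0⟩) (trans (cong (v ⟨$⟩ʳ_) k≡c) (at-b cv))
      ... | ()

      i≡k : suc i ≡ k
      i≡k = trans (sym v⟨g⁻¹0⟩) (fixed cv k≢0 k≢c k≢c)

  -- Walks, balls and their intersections in the star graph.

  private
    Γ : SimpleGraph 0ℓ 0ℓ 0ℓ
    Γ = starGraph (suc m)

    open SimpleGraph Γ using (Adjacent)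

  _≈ₚ?_ : ∀ (x y : V) → Dec (x ≈ₚ y)
  x ≈ₚ? y = all? (λ i → x ⟨$⟩ʳ i ≟ y ⟨$⟩ʳ i)

  permutations : DecSetoid 0ℓ 0ℓ
  permutations = record
    { Carrier = V
    ; _≈_ = _≈ₚ_
    ; isDecEquivalence = record
      { isEquivalence = Group.isEquivalence (Sym (suc m))
      ; _≟_ = _≈ₚ?_
      }
    }

  step-star : ∀ x i {y k} → Walk Γ (x ∙ star (suc i)) y k → Walk Γ x y (suc k)
  step-star x i = step {y = x ∙ star (suc i)}
    (star (suc i) , (zero , suc i , refl , z<s , λ _ → refl) , inj₁ (λ _ → refl))

  -- Adjacency may be witnessed from either end; as transpositions are involutions, it can always be
  -- read as a right multiplication of `x`.
  adjacent⇒star : ∀ x y → Adjacent x y → ∃ λ i → y ≈ₚ x ∙ star (suc i)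
  adjacent⇒star x y (s , (zero , suc i , _ , _ , s≈) , inj₁ y≈xs) =
    i , λ j → trans (y≈xs j) (cong (x ⟨$⟩ʳ_) (s≈ j))
  adjacent⇒star x y (s , (zero , suc i , _ , _ , s≈) , inj₂ x≈ys) =
    i , λ j → sym (trans (x≈ys _) (cong (y ⟨$⟩ʳ_)
          (trans (s≈ _) (transpose-involutive zero (suc i) j))))

  -- Up to `≈ₚ`, the neighbours of `x` are the `m` products `x ∙ star (suc i)`, so a finite search
  -- over `i` decides the first step.
  walk? : ∀ k x y → Dec (Walk Γ x y k)
  walk? zero    x y = map′ stop (λ { (stop x≈y) → x≈y }) (x ≈ₚ? y)
  walk? (suc k) x y = map′
    (λ { (i , w) → step-star x i w })
    (λ { (step {y = z} e w) → let i , z≈ = adjacent⇒star x z e in i , walk-respˡ {Γ = Γ} z≈ w })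
    (any? (λ i → walk? k (x ∙ star (suc i)) y))

  ball₁⇒cyclic : ∀ {x y} → Ball Γ 1 x y → ∃₂ λ w a → Cyclic w a a × y ≈ₚ x ∙ w
  ball₁⇒cyclic (0 , (stop x≈y , _) , _) = ε , zero , cyclic-id , λ i → sym (x≈y i)
  ball₁⇒cyclic {x} (1 , (step {y = z} e (stop z≈y) , _) , _) =
    let i , z≈ = adjacent⇒star x z e in
    star (suc i) , suc i , cyclic-star (suc i) , λ j → trans (sym (z≈y j)) (z≈ j)
  ball₁⇒cyclic (suc (suc _) , _ , s≤s ())

  ball₂⇒cyclic : ∀ {x y} → Ball Γ 2 x y → ∃ λ w → ∃₂ λ a b → Cyclic w a b × y ≈ₚ x ∙ w
  ball₂⇒cyclic (0 , d , _) =
    let w , a , cw , y≈ = ball₁⇒cyclic (0 , d , z≤n) in w , a , a , cw , y≈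
  ball₂⇒cyclic (1 , d , _) =
    let w , a , cw , y≈ = ball₁⇒cyclic (1 , d , s≤s z≤n) in w , a , a , cw , y≈
  ball₂⇒cyclic {x} {y} (2 , (step {y = z₁} e (step {y = z₂} f (stop z≈y)) , _) , _)
    with adjacent⇒star x z₁ e | adjacent⇒star z₁ z₂ f
  -- Equal stars cancel to the identity; distinct ones multiply to a 3-cycle through 0.
  ... | i , z₁≈ | j , z₂≈ = two (i ≟ j)
    where
    y≈ : y ≈ₚ x ∙ (star (suc i) ∙ star (suc j))
    y≈ k = trans (sym (z≈y k)) (trans (z₂≈ k) (z₁≈ _))

    two : Dec (i ≡ j) → ∃ λ w → ∃₂ λ a b → Cyclic w a b × y ≈ₚ x ∙ w
    two (yes refl) = ε , zero , zero , cyclic-id ,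
      λ k → trans (y≈ k) (cong (x ⟨$⟩ʳ_) (transpose-involutive zero (suc i) k))
    two (no i≢j) = star (suc i) ∙ star (suc j) , suc j , suc i ,
      cyclic-star-star (λ ()) (λ ()) (i≢j ∘ suc-injective) , y≈
  ball₂⇒cyclic (suc (suc (suc _)) , _ , s≤s (s≤s ()))

  quotient : V → V → V
  quotient x y = x ⁻¹ ∙ y

  quotient≉ε : ∀ {x y} → ¬ x ≈ₚ y → ¬ quotient x y ≈ₚ ε
  quotient≉ε {x} x≉y q≈ε =
    x≉y (λ i → trans (cong (x ⟨$⟩ʳ_) (sym (q≈ε i))) (inverseʳ x))

  -- A common point `x w = y u` yields `x⁻¹ y = w u⁻¹`; by `cyclic-⁻¹` the second factor is again
  -- cyclic, as the covers require.
  quotient-factors : ∀ {x y z w u} → z ≈ₚ x ∙ w → z ≈ₚ y ∙ u → quotient x y ≈ₚ w ∙ (u ⁻¹)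
  quotient-factors {x} {y} {z} {w} {u} z≈xw z≈yu i = ⟨$⟩ʳ⇒⟨$⟩ˡ x (begin
    x ⟨$⟩ʳ (w ⟨$⟩ʳ (u ⟨$⟩ˡ i))  ≡⟨ z≈xw (u ⟨$⟩ˡ i) ⟨
    z ⟨$⟩ʳ (u ⟨$⟩ˡ i)           ≡⟨ z≈yu (u ⟨$⟩ˡ i) ⟩
    y ⟨$⟩ʳ (u ⟨$⟩ʳ (u ⟨$⟩ˡ i))  ≡⟨ cong (y ⟨$⟩ʳ_) (inverseʳ u) ⟩
    y ⟨$⟩ʳ i                    ∎)
    where open ≡-Reasoning

  intersection-cardinality : ∀ {r k x y} (f : Fin k → V) →
    (∀ {z} → z ∈ Ball Γ r x ∩ Ball Γ r y → ∃ λ i → z ≈ₚ f i) →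
    ∃ λ l → HasCardinality (SimpleGraph.vertices Γ) (Ball Γ r x ∩ Ball Γ r y) l × l ≤ k
  intersection-cardinality {r} {k} {x} {y} = cover⇒cardinality permutations
    (λ z → ball? Γ walk? r x z ×-dec ball? Γ walk? r y z)
    (λ z≈z′ (p , q) → ball-resp {Γ = Γ} z≈z′ p , ball-resp {Γ = Γ} z≈z′ q)

  intersection₁ : ∀ x y → ¬ x ≈ₚ y →
    ∃ λ l → HasCardinality (SimpleGraph.vertices Γ) (Ball Γ 1 x ∩ Ball Γ 1 y) l × l ≤ 2
  intersection₁ x y x≉y with cover₁ (quotient x y) (quotient≉ε {x} {y} x≉y)
  ... | u , covered = intersection-cardinality (λ i → x ∙ u i) λ {z} (p , q) →
    let w  , _ , cw , z≈xw = ball₁⇒cyclic p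
        w′ , _ , cv , z≈yw′ = ball₁⇒cyclic q
        i , w≈ui = covered (quotient-factors {x} {y} {z} {w} {w′} z≈xw z≈yw′) cw (cyclic-⁻¹ cv)
    in i , λ j → trans (z≈xw j) (cong (x ⟨$⟩ʳ_) (w≈ui j))

  intersection₂ : ∀ x y → ¬ x ≈ₚ y →
    ∃ λ l → HasCardinality (SimpleGraph.vertices Γ) (Ball Γ 2 x ∩ Ball Γ 2 y) l × l ≤ 2 * m
  intersection₂ x y x≉y with cover₂ (quotient x y) (quotient≉ε {x} {y} x≉y)
  ... | u , covered = intersection-cardinality (λ i → x ∙ u (remQuot m i)) λ {z} (p , q) →
    let w  , _ , _ , cw , z≈xw = ball₂⇒cyclic p
        w′ , _ , _ , cv , z≈yw′ = ball₂⇒cyclic q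
        (i , j) , w≈u = covered (quotient-factors {x} {y} {z} {w} {w′} z≈xw z≈yw′) cw (cyclic-⁻¹ cv)
    in combine i j , λ l → trans (z≈xw l) (cong (x ⟨$⟩ʳ_)
         (trans (w≈u l) (cong (λ ij → u ij ⟨$⟩ʳ l) (sym (remQuot-combine i j)))))

  star-injective : ∀ {i j} → star i ≈ₚ star j → i ≡ j
  star-injective {i} {j} e = trans (sym (transpose-ˡ zero i)) (trans (e zero) (transpose-ˡ zero j))

  -- At the chosen pair the cardinality is squeezed: `upper` gives at most `k`, and `k` distinct
  -- common points give at least `k`.
  maxBallIntersection : ∀ {r k} →
    (∀ x y → ¬ x ≈ₚ y →
       ∃ λ l → HasCardinality (SimpleGraph.vertices Γ) (Ball Γ r x ∩ Ball Γ r y) l × l ≤ k) →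
    ∀ x y → ¬ x ≈ₚ y → (f : Fin k → V) →
    (∀ i → f i ∈ Ball Γ r x ∩ Ball Γ r y) → (∀ i j → f i ≈ₚ f j → i ≡ j) →
    MaxBallIntersection Γ r k
  maxBallIntersection {r} upper x y x≉y f f∈ f-inj with upper x y x≉y
  ... | l , card , l≤k = (x , y , x≉y , subst (HasCardinality _ _) l≡k card) , upper
    where
    l≡k = ≤-antisym l≤k (injection⇒≤cardinality (SimpleGraph.vertices Γ) card f f∈ f-inj)

-- Attaining both bounds at the adjacent vertices `ε` and `s₁`.

module _ {m : ℕ} where

  private
    n : ℕ
    n = suc (suc m)

    Γ : SimpleGraph 0ℓ 0ℓ 0ℓ
    Γ = starGraph n

    open Group (Sym n) using (_∙_; ε)

    s₁ : Permutation′ n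
    s₁ = star 1F

    ε≉s₁ : ¬ ε ≈ₚ s₁
    ε≉s₁ e with e zero
    ... | ()

    ball : ∀ {r k x y} → Walk Γ x y k → k ≤ r → Ball Γ r x y
    ball = walk⇒ball Γ walk?

  max₁ : MaxBallIntersection Γ 1 2
  max₁ = maxBallIntersection intersection₁ ε s₁ ε≉s₁ f f∈ f-inj
    where
    f : Fin 2 → Permutation′ n
    f 0F = ε
    f 1F = s₁

    f∈ : ∀ i → f i ∈ Ball Γ 1 ε ∩ Ball Γ 1 s₁
    f∈ 0F = ball (stop λ _ → refl) z≤n
          , ball (step-star s₁ 0F (stop (transpose-involutive zero 1F))) ≤-refl
    f∈ 1F = ball (step-star ε 0F (stop λ _ → refl)) ≤-refl , ball (stop λ _ → refl) z≤n

    f-inj : ∀ i j → f i ≈ₚ f j → i ≡ j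
    f-inj 0F 0F _ = refl
    f-inj 0F 1F e = contradiction e ε≉s₁
    f-inj 1F 0F e = contradiction (λ i → sym (e i)) ε≉s₁
    f-inj 1F 1F _ = refl

  max₂ : MaxBallIntersection Γ 2 (2 * suc m)
  max₂ = maxBallIntersection intersection₂ ε s₁ ε≉s₁ (f ∘ remQuot (suc m)) (f∈ ∘ remQuot (suc m))
    (λ i j e → trans (sym (combine-remQuot {2} (suc m) i))
      (trans (cong (uncurry combine) (f-inj (remQuot (suc m) i) (remQuot (suc m) j) e))
        (combine-remQuot {2} (suc m) j)))
    where
    -- These are the neighbours of `ε` and those of `s₁`. As `ε` and `s₁` are adjacent, a neighbour
    -- of one is within distance 2 of the other.
    f : Fin 2 × Fin (suc m) → Permutation′ n
    f (0F , i) = star (suc i)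
    f (1F , i) = s₁ ∙ star (suc i)

    f∈ : ∀ i → f i ∈ Ball Γ 2 ε ∩ Ball Γ 2 s₁
    f∈ (0F , i) = ball (step-star ε i (stop λ _ → refl)) (s≤s z≤n)
      , ball (step-star s₁ 0F (step-star (s₁ ∙ s₁) i
          (stop λ j → transpose-involutive zero 1F (star (suc i) ⟨$⟩ʳ j)))) ≤-refl
    f∈ (1F , i) = ball (step-star ε 0F (step-star s₁ i (stop λ _ → refl))) ≤-refl
      , ball (step-star s₁ i (stop λ _ → refl)) (s≤s z≤n)

    -- At 0 the right side gives 0 if `j` is zero, which the left side never does. Otherwise 0
    -- forces `i = j`, and then `suc i` is sent to 0 on the left but to 1 on the right.
    star≉s₁∙star : ∀ i j → ¬ star (suc i) ≈ₚ s₁ ∙ star (suc j)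
    star≉s₁∙star i zero e with trans (sym (transpose-ˡ zero (suc i))) (e zero)
    ... | ()
    star≉s₁∙star i (suc j) e with trans (sym (transpose-ˡ zero (suc i))) (e zero)
    ... | i≡j with trans (sym (transpose-ʳ zero (suc i))) (trans (e (suc i))
                     (cong (s₁ ⟨$⟩ʳ_) (trans (cong (star (suc (suc j)) ⟨$⟩ʳ_) i≡j) (transpose-ʳ zero (suc (suc j))))))
    ...   | ()

    f-inj : ∀ i j → f i ≈ₚ f j → i ≡ j
    f-inj (0F , i) (0F , j) e = cong (0F ,_) (suc-injective (star-injective e))
    f-inj (0F , i) (1F , j) e = contradiction e (star≉s₁∙star i j)
    f-inj (1F , i) (0F , j) e = contradiction (λ k → sym (e k)) (star≉s₁∙star j i)
    f-inj (1F , i) (1F , j) e =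
      cong (1F ,_) (suc-injective (star-injective λ k → ⟨$⟩ʳ-injective s₁ (e k)))

theorem7 : ∀ (n : ℕ) → 4 ≤ n →
    MaxBallIntersection (starGraph n) 1 2
    × MaxBallIntersection (starGraph n) 2 (2 * (n ∸ 1))
theorem7 (suc (suc m)) _ = max₁ , max₂
theorem7 (suc zero) (s≤s ())
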